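{- Let $p\ge 1$, let $P_n$ be a path on $n$ vertices, let $\lambda$ be a $p$-periodic 1-labeling of $P_n$, and let $\mathcal{P}=(P_n,\lambda)$. Then $M_p(\mathcal{P})=1$.
   Context: A $p$-periodic 1-labeling $\lambda$ of a finite simple undirected graph $G=(V,E)$ assigns to each edge $e$ an infinite set of time-steps of the form $\{i,i+p,i+2p,\dots\}$ with $i\in\{1,\dots,p\}$ (so each edge is present exactly once in every $p$ consecutive time-steps). In the temporal graph $\mathcal{G}=(G,\lambda)$, a journey from $u$ to $v$ is a path in $G$ from $u$ to $v$ together with a choice, for each edge of the path, of a time-step in its label set so that the chosen time-steps are strictly increasing along the path. The temporal distance $\mathrm{dist}_t(u,v)$ is the smallest time-step at which a journey from $u$ reaches $v$ (with $\mathrm{dist}_t(u,u)=0$, and $\infty$ if there is no journey). A set $R\subseteq V$ is a temporal resolving set if (i) for every $v\in V$ there is a journey from some $s\in R$ to $v$ (every vertex is reached from itself), and (ii) for every two distinct $u,v\in V$ there is $s\in R$ with $\mathrm{dist}_t(s,u)\neq\mathrm{dist}_t(s,v)$. $M_p(\mathcal{G})$ denotes the minimum size of a temporal resolving set of $\mathcal{G}$. -}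

module Defs where

open import Data.Fin using (Fin; toℕ)
open import Data.Fin.Subset using (Subset; ∣_∣) renaming (_∈_ to _∈ₛ_)
open import Data.List using (List; []; _∷_)
open import Data.List.Relation.Unary.Unique.Propositional using (Unique)
open import Data.Nat using (ℕ; suc; _+_; _*_; _≤_; _<_)
open import Data.Nat.Properties using (1+n≢n)
open import Data.Product using (Σ; ∃; ∃₂; ∃-syntax; _×_; _,_)
open import Data.Sum using (_⊎_; inj₁; inj₂)
open import Level using (0ℓ)
open import Relation.Binary.Core using (Rel)
open import Relation.Binary.Definitions using (Symmetric; Irreflexive)
open import Relation.Binary.PropositionalEquality using (_≡_; _≢_; refl; sym)
open import Relation.Nullary using (¬_)
open import Relation.Nullary.Construct.Add.Supremum using (_⁺; ⊤⁺; [_])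
open import Relation.Unary using (Pred; _∈_; _≐_)

record Graph (n : ℕ) : Set₁ where
  field
    Adj        : Rel (Fin n) 0ℓ
    adj-sym    : Symmetric Adj
    adj-irrefl : Irreflexive _≡_ Adj

-- `times-sym` makes the time-steps depend only on the undirected edge {u , v}:
-- neither on its orientation nor (applying it twice) on the adjacency proof.
record Labeling {n : ℕ} (G : Graph n) : Set₁ where
  open Graph G
  field
    times          : ∀ u v → Adj u v → Pred ℕ 0ℓ
    times-sym      : ∀ u v (e : Adj u v) (e′ : Adj v u) → times u v e ≐ times v u e′
    times-positive : ∀ u v (e : Adj u v) {t} → t ∈ times u v e → 1 ≤ t

IsPeriodic1Labeling : ∀ {n} {G : Graph n} → ℕ → Labeling G → Set
IsPeriodic1Labeling {G = G} p L =
  ∀ u v (e : Adj u v) →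
    ∃[ i ] (1 ≤ i × i ≤ p × times u v e ≐ (λ t → ∃[ k ] t ≡ i + k * p))
  where
  open Graph G
  open Labeling L

module _ {n : ℕ} {G : Graph n} (L : Labeling G) where
  open Graph G
  open Labeling L

  -- `TemporalWalk u v t` : walks from u with strictly increasing time-steps
  -- that reach v at time t.  The trivial walk arrives at time 0; as time-steps
  -- are positive, the condition `t < t′` is void for the first edge.
  data TemporalWalk (u : Fin n) : Fin n → ℕ → Set where
    trivial : TemporalWalk u u 0
    extend  : ∀ {v w t t′} → TemporalWalk u v t →
              (e : Adj v w) → t′ ∈ times v w e → t < t′ →
              TemporalWalk u w t′

  vertices : ∀ {u v t} → TemporalWalk u v t → List (Fin n)
  vertices {u} trivial                    = u ∷ []
  vertices {v = w}     (extend walk _ _ _) = w ∷ vertices walk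

  Journey : Fin n → Fin n → ℕ → Set
  Journey u v t = Σ (TemporalWalk u v t) λ walk → Unique (vertices walk)

  -- `IsDist u v d` : dist_t(u , v) = d, with ⊤⁺ standing for ∞.
  IsDist : Fin n → Fin n → ℕ ⁺ → Set
  IsDist u v [ d ] = Journey u v d × (∀ t → Journey u v t → d ≤ t)
  IsDist u v ⊤⁺    = ¬ (∃[ t ] Journey u v t)

  DistDiffers : Fin n → Fin n → Fin n → Set
  DistDiffers s u v = ∃₂ λ d d′ → IsDist s u d × IsDist s v d′ × d ≢ d′

  record IsTemporalResolving (R : Subset n) : Set where
    field
      reaches   : ∀ v → ∃[ s ] (s ∈ₛ R × ∃[ t ] Journey s v t)
      separates : ∀ u v → u ≢ v → ∃[ s ] (s ∈ₛ R × DistDiffers s u v)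

  -- `IsMinResolvingSize k` : the minimum size of a temporal resolving set is k.
  IsMinResolvingSize : ℕ → Set
  IsMinResolvingSize k =
    (∃[ R ] (IsTemporalResolving R × ∣ R ∣ ≡ k)) ×
    (∀ R → IsTemporalResolving R → k ≤ ∣ R ∣)

path : ∀ n → Graph n
path n = record
  { Adj        = λ u v → toℕ v ≡ suc (toℕ u) ⊎ toℕ u ≡ suc (toℕ v)
  ; adj-sym    = λ { (inj₁ q) → inj₂ q ; (inj₂ q) → inj₁ q }
  ; adj-irrefl = λ { refl (inj₁ q) → 1+n≢n (sym q) ; refl (inj₂ q) → 1+n≢n (sym q) }
  }

{-# OPTIONS --safe #-}
module Submission where

open import Defs
open import Data.Empty using (⊥-elim)
open import Data.Fin using (Fin; zero; suc; toℕ; inject₁)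
open import Data.Fin.Induction using (<-weakInduction)
open import Data.Fin.Properties using (toℕ-inject₁; toℕ-injective)
open import Data.Fin.Subset using (⁅_⁆; ∣_∣)
open import Data.Fin.Subset.Properties using (x∈⁅x⁆; ∣⁅x⁆∣≡1; x∈p⇒∣p-x∣<∣p∣)
open import Data.List.Relation.Unary.All as All using (All; []; _∷_)
open import Data.List.Relation.Unary.AllPairs using ([]; _∷_)
open import Data.List.Relation.Unary.Unique.Propositional using (Unique)
open import Data.Nat using (ℕ; zero; suc; _+_; _*_; _≤_; _<_; z≤n; s≤s; s≤s⁻¹; _≤?_)
open import Data.Nat.Properties
open import Data.Product using (∃-syntax; _×_; _,_; proj₁; proj₂)
open import Data.Sum using (inj₁; inj₂)
open import Relation.Binary.Definitions using (tri<; tri≈; tri>)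
open import Relation.Binary.PropositionalEquality using (_≡_; _≢_; refl; sym; cong; subst)
open import Relation.Nullary using (yes; no)
open import Relation.Nullary.Construct.Add.Supremum using ([_]; []-injective)
open import Relation.Unary using (Pred; _∈_; _≐_)

-- Take the resolving set to consist of one end s of the path.  Reaching a
-- vertex beyond v requires passing through v first, and time-steps strictly
-- increase along a journey, so the temporal distance from s strictly increases
-- with the position on the path.  It is finite because every edge recurs
-- forever, and it is computed greedily: take the next edge as soon as possible.

LeastAfter : ∀ {ℓ} → Pred ℕ ℓ → ℕ → ℕ → Set ℓ
LeastAfter A d t = t ∈ A × d < t × (∀ {t′} → t′ ∈ A → d < t′ → t ≤ t′)

leastAfter-≐ : ∀ {a b} {A : Pred ℕ a} {B : Pred ℕ b} → A ≐ B →
               ∀ {d t} → LeastAfter B d t → LeastAfter A d t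
leastAfter-≐ (A⊆B , B⊆A) (t∈B , d<t , least) =
  B⊆A t∈B , d<t , λ t′∈A → least (A⊆B t′∈A)

-- Induction on `d`: the least term after `d` also serves for `suc d`, unless it equals `suc d`;
-- then the term one period later takes over.
leastAfter-progression : ∀ {i p} → 1 ≤ i → 1 ≤ p → ∀ d →
                         ∃[ t ] LeastAfter (λ t → ∃[ k ] t ≡ i + k * p) d t
leastAfter-progression {i} {p} 1≤i 1≤p zero =
  i , (0 , sym (+-identityʳ i)) , 1≤i , λ { (k , refl) _ → m≤m+n i (k * p) }
leastAfter-progression {i} {p} 1≤i 1≤p (suc d)
  with leastAfter-progression 1≤i 1≤p d
... | t , t∈A@(k , t≡) , d<t , least with m≤n⇒m<n∨m≡n d<t
...   | inj₁ 1+d<t = t , t∈A , 1+d<t , λ t′∈A 1+d<t′ → least t′∈A (m+n≤o⇒n≤o 1 1+d<t′)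
...   | inj₂ 1+d≡t =
  i + suc k * p , (suc k , refl) ,
  subst (_< i + suc k * p) (sym 1+d≡i+kp)
    (+-monoʳ-< i (m<n+m (k * p) 1≤p)) ,
  -- A term beyond `i + k * p` has `k < k′`, hence `suc k ≤ k′`.
  λ { (k′ , refl) 1+d<t′ →
      +-monoʳ-≤ i (*-monoˡ-≤ p
        (*-cancelʳ-< p k k′ (+-cancelˡ-< i _ _ (subst (_< i + k′ * p) 1+d≡i+kp 1+d<t′)))) }
  where
  1+d≡i+kp : suc d ≡ i + k * p
  1+d≡i+kp rewrite 1+d≡t = t≡

module _ {m : ℕ} (L : Labeling (path (suc m))) where
  open Graph (path (suc m))
  open Labeling L

  -- Applying `times-sym` to the reversed edge and back exchanges one adjacency proof for another.
  times-irrelevant : ∀ {u v e e′ t} → t ∈ times u v e → t ∈ times u v e′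
  times-irrelevant {u} {v} {e} {e′} t∈ =
    proj₂ (times-sym u v e′ (adj-sym e)) (proj₁ (times-sym u v e (adj-sym e)) t∈)

  -- The bound ranges over walks to all vertices from v on, so that it can be
  -- proved by induction on walks that may go back and forth.
  record FirstArrival (v : Fin (suc m)) : Set where
    field
      time     : ℕ
      walk     : TemporalWalk L zero v time
      below    : All (λ x → toℕ x ≤ toℕ v) (vertices L walk)
      unique   : Unique (vertices L walk)
      earliest : ∀ {w t} → toℕ v ≤ toℕ w → TemporalWalk L zero w t → time ≤ t

    journey : Journey L zero v time
    journey = walk , unique

    isDist : IsDist L zero v [ time ]
    isDist = journey , λ t j → earliest ≤-refl (proj₁ j)

    -- The last edge of the walk, in either direction, starts at `v` or beyond it, so `earliest`
    -- bounds the time before that edge is crossed.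
    time<beyond : ∀ {w t} → toℕ v < toℕ w → TemporalWalk L zero w t → time < t
    time<beyond v<w (extend walk (inj₁ w≡1+x) _ t<t′) =
      ≤-<-trans (earliest (s≤s⁻¹ (subst (_ <_) w≡1+x v<w)) walk) t<t′
    time<beyond v<w (extend walk (inj₂ x≡1+w) _ t<t′) =
      ≤-<-trans (earliest (≤-trans (<⇒≤ v<w) (subst (_ ≤_) (sym x≡1+w) (n≤1+n _))) walk) t<t′

  open FirstArrival

  firstArrival-zero : FirstArrival zero
  firstArrival-zero = record
    { time     = 0
    ; walk     = trivial
    ; below    = z≤n ∷ []
    ; unique   = [] ∷ []
    ; earliest = λ _ _ → z≤n
    }

  module _ {p : ℕ} (1≤p : 1 ≤ p) (periodic : IsPeriodic1Labeling p L) where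

    leastAfter-times : ∀ u v e d → ∃[ t ] LeastAfter (times u v e) d t
    leastAfter-times u v e d with periodic u v e
    ... | i , 1≤i , _ , times≐ with leastAfter-progression 1≤i 1≤p d
    ...   | t , t-least = t , leastAfter-≐ times≐ t-least

    firstArrival-suc : ∀ i → FirstArrival (inject₁ i) → FirstArrival (suc i)
    firstArrival-suc i F with leastAfter-times (inject₁ i) (suc i)
                                (inj₁ (cong suc (sym (toℕ-inject₁ i)))) (time F)
    ... | t , t∈times , F<t , least = record
      { time     = t
      ; walk     = extend (walk F) _ t∈times F<t
      ; below    = ≤-refl ∷ All.map (λ x≤i → <⇒≤ (below⇒< x≤i)) (below F)
      -- By `below F`, every vertex visited so far lies strictly before `suc i`.
      ; unique   = All.map (λ x≤i → λ { refl → <-irrefl refl (below⇒< x≤i) }) (below F) ∷ unique F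
      ; earliest = earliest′
      }
      where
      below⇒< : ∀ {x : Fin (suc m)} → toℕ x ≤ toℕ (inject₁ i) → toℕ x < suc (toℕ i)
      below⇒< {x} x≤i = s≤s (subst (toℕ x ≤_) (toℕ-inject₁ i) x≤i)

      -- Strip last edges as long as the walk without them still ends at `suc i` or beyond. What
      -- remains ends by crossing from `inject₁ i` to `suc i`, after an arrival at `inject₁ i` no
      -- earlier than `time F`.
      earliest′ : ∀ {w t′} → suc (toℕ i) ≤ toℕ w → TemporalWalk L zero w t′ → t ≤ t′
      earliest′ {w} {t′} i<w (extend {v = x} walk e t′∈ t″<t′) with suc (toℕ i) ≤? toℕ x
      ... | yes i<x = ≤-trans (earliest′ i<x walk) (<⇒≤ t″<t′)
      ... | no  i≮x with e
      ...   | inj₂ x≡1+w = ⊥-elim (i≮x (subst (_ ≤_) (sym x≡1+w) (m≤n⇒m≤1+n i<w)))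
      ...   | inj₁ w≡1+x
        -- From `x ≤ i < w = 1 + x`, the edge must be the one between `inject₁ i` and `suc i`.
        with refl ← toℕ-injective {i = x} {j = inject₁ i}
                      (≤-antisym (subst (toℕ x ≤_) (sym (toℕ-inject₁ i)) (s≤s⁻¹ (≰⇒> i≮x)))
                                 (subst (_≤ toℕ x) (sym (toℕ-inject₁ i)) (s≤s⁻¹ (subst (_ <_) w≡1+x i<w))))
        with refl ← toℕ-injective {i = w} {j = suc i}
                      (subst (λ k → toℕ w ≡ suc k) (toℕ-inject₁ i) w≡1+x)
        = least (times-irrelevant t′∈) (≤-<-trans (earliest F ≤-refl walk) t″<t′)

    firstArrival : ∀ v → FirstArrival v
    firstArrival = <-weakInduction FirstArrival firstArrival-zero firstArrival-suc

    distDiffers : ∀ u v → u ≢ v → DistDiffers L zero u v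
    distDiffers u v u≢v =
      [ time Fu ] , [ time Fv ] , isDist Fu , isDist Fv , λ eq → differ ([]-injective eq)
      where
      Fu = firstArrival u
      Fv = firstArrival v

      differ : time Fu ≢ time Fv
      -- The walk to the farther vertex is one beyond the nearer vertex.
      differ with <-cmp (toℕ u) (toℕ v)
      ... | tri< u<v _ _ = <⇒≢ (time<beyond Fu u<v (walk Fv))
      ... | tri≈ _ u≡v _ = ⊥-elim (u≢v (toℕ-injective u≡v))
      ... | tri> _ _ v<u = >⇒≢ (time<beyond Fv v<u (walk Fu))

theorem10 : (p n : ℕ) → 1 ≤ p → 1 ≤ n →
    (L : Labeling (path n)) → IsPeriodic1Labeling p L →
    IsMinResolvingSize L 1
theorem10 p (suc m) 1≤p _ L periodic =
  (⁅ zero ⁆ , resolving , ∣⁅x⁆∣≡1 {n = suc m} zero) , nonempty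
  where
  resolving : IsTemporalResolving L ⁅ zero ⁆
  resolving = record
    { reaches   = λ v → zero , x∈⁅x⁆ zero , _ , FirstArrival.journey (firstArrival L 1≤p periodic v)
    ; separates = λ u v u≢v → zero , x∈⁅x⁆ zero , distDiffers L 1≤p periodic u v u≢v
    }

  nonempty : ∀ R → IsTemporalResolving L R → 1 ≤ ∣ R ∣
  nonempty R res with IsTemporalResolving.reaches res zero
  -- Removing `s` strictly lowers the size of `R`, which is therefore positive.
  ... | s , s∈R , _ = ≤-<-trans z≤n (x∈p⇒∣p-x∣<∣p∣ s∈R)
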